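{- Let $k\ge 2$ be an integer. For every $k$-ary tree $T$, there is a canonically labelled graph $G$ such that $T\simeq\mathsf{TS}_{k+1}(G)$.
   Context: Graphs are finite, simple, undirected and vertex-labelled; $\simeq$ denotes isomorphism. For a graph $G$ and an integer $m\ge 2$, $\mathsf{TS}_m(G)$ is the graph whose nodes are all size-$m$ independent sets of $G$, two nodes $I,J$ being adjacent if there are vertices $u,v$ of $G$ with $I\setminus J=\{u\}$, $J\setminus I=\{v\}$ and $uv\in E(G)$; each node is labelled by its independent set. A $k$-ary tree is a rooted tree in which each node has at most $k$ children. Let $I_{k+1}=\{a_1,\dots,a_{k+1}\}$ and let $b_1,\dots,b_k$ be further distinct labels. If $k\ge 2$ and $T:=\mathsf{TS}_{k+1}(G)$ is a ($k$-ary, rooted) tree, then $G$ and $T$ are called canonically labelled if: (a) the root of $T$ is labelled $I_{k+1}$; (b) the $d\le k$ children of the root are labelled $(I_{k+1}\setminus\{a_i\})\cup\{b_i\}$, $i=1,\dots,d$; (c) the labels $b_j$, $j=d+1,\dots,k$ (if any) are not used; (d) every other node of $T$ has a label $S$ with $|I_{k+1}\cap S|\le k-1$. -}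

module Defs where

open import Data.Bool.Properties using () renaming (_≟_ to _≟ᵇ_)
open import Data.Fin using (Fin; toℕ; inject₁)
open import Data.Fin.Properties using (any?)
open import Data.Fin.Subset using (Subset; _∈_; _∩_; _─_; ⁅_⁆; ∣_∣)
open import Data.Fin.Subset.Properties using (x∈⁅x⁆; x∈⁅y⁆⇒x≡y)
open import Data.List using (List; []; _∷_; length)
open import Data.List.Membership.Propositional using () renaming (_∈_ to _∈ˡ_)
open import Data.List.Relation.Unary.All using (All)
open import Data.List.Relation.Unary.Unique.Propositional using (Unique)
open import Data.Nat using (ℕ; suc; _∸_; _≤_; _<_)
open import Data.Product using (Σ-syntax; ∃-syntax; ∃₂; _×_; _,_)
open import Data.Sum using (_⊎_)
open import Data.Vec.Properties using (≡-dec)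
open import Function using (Injective; _↔_; _⇔_; Inverse)
open import Relation.Binary using (Decidable; Symmetric; Irreflexive)
open import Relation.Binary.Construct.Closure.ReflexiveTransitive using (Star; ε; _◅_)
open import Relation.Binary.PropositionalEquality using (_≡_; _≢_; refl; sym; trans; subst)
open import Relation.Nullary using (¬_; _×-dec_)
open import Relation.Unary using (Pred; _≐_)
open import Level using (0ℓ)

record Graph (V : Set) : Set₁ where
  field
    Adj        : V → V → Set
    adj?       : Decidable Adj
    adj-sym    : Symmetric Adj
    adj-irrefl : Irreflexive _≡_ Adj

module _ {V : Set} (G : Graph V) where
  open Graph G

  Walk : V → V → Set
  Walk = Star Adj

  vertices : ∀ {u v} → Walk u v → List V
  vertices {u} ε       = u ∷ []
  vertices {u} (_ ◅ p) = u ∷ vertices p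

  IsPath : ∀ {u v} → Walk u v → Set
  IsPath p = Unique (vertices p)

  Connected : Set
  Connected = ∀ u v → Walk u v

  -- A cycle is a path on at least three vertices whose ends are adjacent.
  Cycle : Set
  Cycle = ∃₂ λ u v → Σ[ p ∈ Walk u v ] IsPath p × 3 ≤ length (vertices p) × Adj v u

  IsTree : Set
  IsTree = Connected × ¬ Cycle

  -- In the tree rooted at r, the vertex w is a child of its neighbour v
  -- when v lies on the path from r to w.
  IsChild : (r v w : V) → Set
  IsChild r v w = Adj v w × (Σ[ p ∈ Walk r w ] IsPath p × v ∈ˡ vertices p)

  record IsKaryTree (k : ℕ) (r : V) : Set where
    field
      isTree      : IsTree
      fewChildren : ∀ v (ws : List V) → Unique ws → All (IsChild r v) ws → length ws ≤ k

record KaryTree (k : ℕ) : Set₁ where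
  field
    order      : ℕ
    graph      : Graph (Fin order)
    root       : Fin order
    isKaryTree : IsKaryTree graph k root

record RootedIso {V W : Set} (G : Graph V) (r : V) (H : Graph W) (s : W) : Set where
  field
    bijection : V ↔ W
  open Inverse bijection using (to) public
  field
    preservesAdj  : ∀ u v → Graph.Adj G u v ⇔ Graph.Adj H (to u) (to v)
    preservesRoot : to r ≡ s

module _ {n : ℕ} (G : Graph (Fin n)) where
  open Graph G

  Independent : Subset n → Set
  Independent S = ∀ {u v} → u ∈ S → v ∈ S → ¬ Adj u v

  -- The proofs are irrelevant, so nodes are equal exactly when their sets are.
  record Node (m : ℕ) : Set where
    constructor node
    field
      set          : Subset n
      .size        : ∣ set ∣ ≡ m
      .independent : Independent set

  open Node public

  TS : (m : ℕ) → Graph (Node m)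
  TS m = record
    { Adj        = Slide
    ; adj?       = λ I J → any? λ u → any? λ v →
                     ≡-dec _≟ᵇ_ (set I ─ set J) ⁅ u ⁆ ×-dec
                     ≡-dec _≟ᵇ_ (set J ─ set I) ⁅ v ⁆ ×-dec adj? u v
    ; adj-sym    = λ (u , v , p , q , e) → v , u , q , p , adj-sym e
    ; adj-irrefl = λ { refl (u , v , p , q , e) →
                     adj-irrefl (x∈⁅y⁆⇒x≡y v (subst (u ∈_) (trans (sym p) q) (x∈⁅x⁆ u))) e }
    }
    where
    Slide : Node m → Node m → Set
    Slide I J = ∃[ u ] ∃[ v ] (set I ─ set J ≡ ⁅ u ⁆) × (set J ─ set I ≡ ⁅ v ⁆) × Adj u v

-- The distinguished labels a₁,…,aₖ₊₁ and b₁,…,bₖ (indexed from zero),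
-- together with an infinite supply of further labels.
data Label (k : ℕ) : Set where
  a     : Fin (suc k) → Label k
  b     : Fin k → Label k
  other : ℕ → Label k

record LabelledGraph (L : Set) : Set₁ where
  field
    order           : ℕ
    graph           : Graph (Fin order)
    label           : Fin order → L
    label-injective : Injective _≡_ _≡_ label

  labels : Subset order → Pred L 0ℓ
  labels S x = ∃[ v ] v ∈ S × label v ≡ x

Iₖ₊₁ : ∀ {k} → Pred (Label k) 0ℓ
Iₖ₊₁ x = ∃[ i ] x ≡ a i

childLabels : ∀ {k} → Fin k → Pred (Label k) 0ℓ
childLabels i x = (Iₖ₊₁ x × x ≢ a (inject₁ i)) ⊎ x ≡ b i

record CanonicallyLabelled {k : ℕ} (G : LabelledGraph (Label k))
         (root : Node (LabelledGraph.graph G) (suc k)) : Set where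
  open LabelledGraph G
  T : Graph (Node graph (suc k))
  T = TS graph (suc k)
  field
    isKaryTree    : IsKaryTree T k root
    rootLabel     : labels (set root) ≐ Iₖ₊₁
    d             : ℕ
    d≤k           : d ≤ k
    -- Distinct i give distinct label sets, so the next two fields say that
    -- the root has exactly d children.
    childExists   : ∀ i → toℕ i < d →
                    ∃[ J ] IsChild T root root J × (labels (set J) ≐ childLabels i)
    childLabelled : ∀ J → IsChild T root root J →
                    ∃[ i ] toℕ i < d × (labels (set J) ≐ childLabels i)
    unusedLabels  : ∀ j → d ≤ toℕ j → ∀ v → label v ≢ b j
    -- By rootLabel, set root consists of the vertices with labels in Iₖ₊₁.
    otherNodes    : ∀ S → S ≢ root → ¬ IsChild T root root S →
                    ∣ set root ∩ set S ∣ ≤ k ∸ 1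

{-# OPTIONS --safe #-}

-- The root of the tree takes a fresh clique of k + 1 vertices in the complement
-- of G.  Each child takes the clique (bag) of its parent with one vertex exchanged
-- for a new one; the vertex given up differs between siblings and is never the one
-- that the parent itself introduced.  When a new vertex inherits the colour of the
-- vertex it replaces, every bag has one vertex of each of k + 1 colours.  Two
-- vertices of G are adjacent when no bag contains both.  A set of k + 1 pairwise
-- cohabiting vertices is the bag of its deepest member, so the independent sets
-- of size k + 1 are exactly the bags.  If the bags of u and v agree off one colour,
-- then the parent of each is an ancestor of the other, so u and v are parent and
-- child or siblings, and the bags of siblings differ in two colours.
module Submission where

open import Defs
open import Data.Bool using (if_then_else_)
open import Data.Bool.Properties using () renaming (_≟_ to _≟ᵇ_)
open import Data.Fin
  using (Fin; zero; suc; toℕ; inject₁; inject≤; fromℕ; fromℕ<; punchIn; splitAt; join; _↑ˡ_; _↑ʳ_)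
open import Data.Fin.Properties
  using (_≟_; any?; suc-injective; toℕ-injective; toℕ-inject≤; toℕ-fromℕ<; toℕ<n; fromℕ≢inject₁;
         inject₁-injective; punchIn-injective; punchInᵢ≢i; splitAt-↑ˡ; splitAt-↑ʳ; join-splitAt;
         ↑ˡ-injective; ↑ʳ-injective)
import Data.Fin.Relation.Unary.Top as Top
open import Data.Fin.Subset
  using (Subset; inside; outside; ⊥; ⁅_⁆; _∪_; _∩_; _─_; _-_; _∈_; _∉_; _⊆_; ∣_∣)
open import Data.Fin.Subset.Properties
  using (_∈?_; ∉⊥; ∣⊥∣≡0; ⊆-antisym; x∈⁅x⁆; x∈⁅y⁆⇒x≡y; p⊆q⇒∣p∣≤∣q∣; p⊂q⇒∣p∣<∣q∣; x∈p∩q⁻;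
         ∪-identityˡ; x∈p∪q⁺; x∈p∪q⁻; p─q⊆p; x∈p∧x∉q⇒x∈p─q; x∈p∧x≢y⇒x∈p-y; x∈p⇒∣p-x∣<∣p∣)
open import Data.List using (List; []; _∷_; length; drop; reverse; _ʳ++_; filter; allFin)
import Data.List as List
open import Data.List.Extrema.Nat using (argmax; argmax-all; f[xs]≤f[argmax])
open import Data.List.Membership.DecPropositional using () renaming (_∈?_ to _∈ˡ?_)
open import Data.List.Membership.Propositional using () renaming (_∈_ to _∈ˡ_; _∉_ to _∉ˡ_)
open import Data.List.Membership.Propositional.Properties
  using (∈-map⁺; ∈-filter⁺; ∈-filter⁻; ∈-allFin; ∈-lookup)
open import Data.List.Membership.Setoid.Properties using (index-injective)
open import Data.List.Properties using (length-map; ∷-injectiveʳ)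
open import Data.List.Relation.Binary.Permutation.Propositional using (↭-sym; ↭⇒↭ₛ)
open import Data.List.Relation.Binary.Permutation.Propositional.Properties using (↭-reverse; ∈-resp-↭)
import Data.List.Relation.Binary.Permutation.Setoid.Properties as Permutation
open import Data.List.Relation.Binary.Subset.Propositional using () renaming (_⊆_ to _⊆ˡ_)
open import Data.List.Relation.Unary.All as All using (All; []; _∷_)
import Data.List.Relation.Unary.All.Properties as All
open import Data.List.Relation.Unary.AllPairs using ([]; _∷_)
open import Data.List.Relation.Unary.Any using (here; there; index)
open import Data.List.Relation.Unary.Any.Properties using (lookup-index)
open import Data.List.Relation.Unary.Unique.Propositional using (Unique)
import Data.List.Relation.Unary.Unique.Propositional.Properties as Unique
open import Data.Nat using (ℕ; zero; suc; _+_; _∸_; _≤_; _<_; z≤n; s≤s; s≤s⁻¹)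
import Data.Nat.Properties as ℕ
open import Data.Product using (Σ-syntax; ∃-syntax; _×_; _,_; proj₁; proj₂)
open import Data.Sum as Sum using (_⊎_; inj₁; inj₂; [_,_]′)
open import Data.Vec using ([]; _∷_; here; there)
open import Data.Vec.Properties using (≡-dec)
open import Function using (_∘_; id; Injective; Inverse; Equivalence; mk⇔; mk↔ₛ′)
open import Level using (0ℓ)
open import Relation.Binary using (_=[_]⇒_; DecidableEquality)
open import Relation.Binary.Construct.Closure.ReflexiveTransitive as Star
  using (ε; _◅_; _◅◅_; gmap; revApp)
open import Relation.Binary.PropositionalEquality
  using (_≡_; _≢_; refl; sym; trans; cong; subst; subst₂; ≢-sym; setoid; module ≡-Reasoning)
open import Relation.Nullary using (¬_; Dec; yes; no; does; contradiction; ¬?; _×-dec_; recompute; decidable-stable)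
open import Relation.Nullary.Decidable using (dec-true; dec-false)
open import Relation.Unary using (Pred; Decidable; _≐_)

-- Repetition-free lists, and rooted trees under isomorphism.

Unique-reverse : ∀ {A : Set} {xs : List A} → Unique xs → Unique (reverse xs)
Unique-reverse {A} {xs} =
  Permutation.Unique-resp-↭ (setoid A) (↭⇒↭ₛ (↭-sym (↭-reverse xs)))

∉⇒All≢ : ∀ {A : Set} {x : A} {xs} → x ∉ˡ xs → All (x ≢_) xs
∉⇒All≢ = All.¬Any⇒All¬ _

All≢⇒∉ : ∀ {A : Set} {x : A} {xs} → All (x ≢_) xs → x ∉ˡ xs
All≢⇒∉ = All.All¬⇒¬Any

module _ {V W : Set} {G : Graph V} {H : Graph W} (f : V → W)
         (f-adj : Graph.Adj G =[ f ]⇒ Graph.Adj H) where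

  vertices-gmap : ∀ {u v} (p : Walk G u v) →
                  vertices H (gmap f f-adj p) ≡ List.map f (vertices G p)
  vertices-gmap ε       = refl
  vertices-gmap (_ ◅ p) = cong (_ ∷_) (vertices-gmap p)

  module _ (f-injective : Injective _≡_ _≡_ f) where

    gmap-isPath : ∀ {u v} (p : Walk G u v) → IsPath G p → IsPath H (gmap f f-adj p)
    gmap-isPath p p-path =
      subst Unique (sym (vertices-gmap p)) (Unique.map⁺ f-injective p-path)

    map-cycle : Cycle G → Cycle H
    map-cycle (u , v , p , p-path , 3≤ , vu) =
      f u , f v , gmap f f-adj p , gmap-isPath p p-path ,
      subst (3 ≤_) (sym (trans (cong length (vertices-gmap p)) (length-map f (vertices G p)))) 3≤ ,
      f-adj vu

    map-isChild : ∀ {r v w} → IsChild G r v w → IsChild H (f r) (f v) (f w)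
    map-isChild (vw , p , p-path , v∈p) =
      f-adj vw , gmap f f-adj p , gmap-isPath p p-path ,
      subst (f _ ∈ˡ_) (sym (vertices-gmap p)) (∈-map⁺ f v∈p)

-- Cycles and lists of children in `H` are pulled back along the inverse bijection. The graph `TS`
-- is shown to be a `k`-ary tree in this way, with no separate argument about its cycles.
isKaryTree-resp-≃ : ∀ {V W : Set} {G : Graph V} {H : Graph W} {r s k} →
                    RootedIso G r H s → IsKaryTree G k r → IsKaryTree H k s
isKaryTree-resp-≃ {G = G} {H} {r} {s} {k} iso G-tree = record
  { isTree      = H-connected , proj₂ isTree ∘ map-cycle from from-adj from-injective
  ; fewChildren = λ v ws ws-unique ws-children →
      subst (_≤ k) (length-map from ws)
        (fewChildren (from v) (List.map from ws)
          (Unique.map⁺ from-injective ws-unique)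
          (All.map⁺ (All.map
            (subst (λ t → IsChild G t _ _) from-root ∘ map-isChild from from-adj from-injective)
            ws-children)))
  }
  where
  open IsKaryTree G-tree
  open RootedIso iso
  open Inverse bijection using (from; strictlyInverseˡ; strictlyInverseʳ)

  from-injective : Injective _≡_ _≡_ from
  from-injective {x} {y} eq =
    trans (sym (strictlyInverseˡ x)) (trans (cong to eq) (strictlyInverseˡ y))

  from-adj : Graph.Adj H =[ from ]⇒ Graph.Adj G
  from-adj e = Equivalence.from (preservesAdj _ _)
    (subst₂ (Graph.Adj H) (sym (strictlyInverseˡ _)) (sym (strictlyInverseˡ _)) e)

  from-root : from s ≡ r
  from-root = trans (cong from (sym preservesRoot)) (strictlyInverseʳ r)

  H-connected : Connected H
  H-connected u v = subst₂ (Walk H) (strictlyInverseˡ u) (strictlyInverseˡ v)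
    (gmap to (Equivalence.to (preservesAdj _ _)) (proj₁ isTree (from u) (from v)))

-- Walks, and uniqueness of paths in acyclic graphs.

module Paths {V : Set} (_≟ᵥ_ : DecidableEquality V) (G : Graph V) where
  open Graph G

  start∈ : ∀ {u v} (p : Walk G u v) → u ∈ˡ vertices G p
  start∈ ε       = here refl
  start∈ (_ ◅ _) = here refl

  end∈ : ∀ {u v} (p : Walk G u v) → v ∈ˡ vertices G p
  end∈ ε       = here refl
  end∈ (_ ◅ p) = there (end∈ p)

  ∈-◅◅⁻ : ∀ {u v w x} (p : Walk G u v) (q : Walk G v w) →
          x ∈ˡ vertices G (p ◅◅ q) → x ∈ˡ vertices G p ⊎ x ∈ˡ vertices G q
  ∈-◅◅⁻ ε       q x∈         = inj₂ x∈
  ∈-◅◅⁻ (_ ◅ p) q (here eq)  = inj₁ (here eq)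
  ∈-◅◅⁻ (_ ◅ p) q (there x∈) = Sum.map₁ there (∈-◅◅⁻ p q x∈)

  rev : ∀ {u v} → Walk G u v → Walk G v u
  rev = Star.reverse adj-sym

  vertices-head : ∀ {u v} (p : Walk G u v) → vertices G p ≡ u ∷ drop 1 (vertices G p)
  vertices-head ε       = refl
  vertices-head (_ ◅ _) = refl

  -- Both walks start at `u`; `drop 1` keeps this vertex from being listed twice.
  vertices-revApp : ∀ {u v w} (p : Walk G u v) (q : Walk G u w) →
                    vertices G (revApp {U = Adj} adj-sym p q) ≡ vertices G p ʳ++ drop 1 (vertices G q)
  vertices-revApp ε       q = vertices-head q
  vertices-revApp (e ◅ p) q = trans (vertices-revApp p (adj-sym e ◅ q))
                                    (cong (vertices G p ʳ++_) (vertices-head q))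

  vertices-rev : ∀ {u v} (p : Walk G u v) → vertices G (rev p) ≡ reverse (vertices G p)
  vertices-rev p = vertices-revApp p ε

  ∈-rev⁺ : ∀ {u v x} (p : Walk G u v) → x ∈ˡ vertices G p → x ∈ˡ vertices G (rev p)
  ∈-rev⁺ p x∈ rewrite vertices-rev p = ∈-resp-↭ (↭-sym (↭-reverse (vertices G p))) x∈

  ∈-rev⁻ : ∀ {u v x} (p : Walk G u v) → x ∈ˡ vertices G (rev p) → x ∈ˡ vertices G p
  ∈-rev⁻ p x∈ rewrite vertices-rev p = ∈-resp-↭ (↭-reverse (vertices G p)) x∈

  rev-isPath : ∀ {u v} (p : Walk G u v) → IsPath G p → IsPath G (rev p)
  rev-isPath p p-path rewrite vertices-rev p = Unique-reverse p-path

  suffix : ∀ {u v x} (p : Walk G u v) → IsPath G p → x ∈ˡ vertices G p →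
           Σ[ q ∈ Walk G x v ] IsPath G q × vertices G q ⊆ˡ vertices G p
  suffix ε       p-path       (here refl) = ε , p-path , id
  suffix (e ◅ p) p-path       (here refl) = e ◅ p , p-path , id
  suffix (e ◅ p) (_ ∷ p-path) (there x∈)  =
    let q , q-path , q⊆p = suffix p p-path x∈ in q , q-path , there ∘ q⊆p

  -- Loop erasure: if the new first vertex already lies on the shortened tail, the tail is cut to
  -- begin there. The inclusion of vertices ensures that whatever `p` avoids stays avoided, as
  -- `no-bypass` requires.
  shorten : ∀ {u v} (p : Walk G u v) →
            Σ[ q ∈ Walk G u v ] IsPath G q × vertices G q ⊆ˡ vertices G p
  shorten ε = ε , [] ∷ [] , id
  shorten {u} (e ◅ p) with shorten p
  ... | q , q-path , q⊆p with _∈ˡ?_ _≟ᵥ_ u (vertices G q)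
  ...   | yes u∈q = let s , s-path , s⊆q = suffix q q-path u∈q in s , s-path , there ∘ q⊆p ∘ s⊆q
  ...   | no  u∉q = e ◅ q , ∉⇒All≢ u∉q ∷ q-path ,
                    λ { (here eq) → here eq ; (there x∈) → there (q⊆p x∈) }

  module _ (acyclic : ¬ Cycle G) where

    -- A walk between two neighbours of x that avoids x closes up to a cycle through x.
    no-bypass : ∀ {x u v} → Adj x u → Adj x v → u ≢ v → (p : Walk G u v) → ¬ x ∉ˡ vertices G p
    no-bypass {x} {u} {v} xu xv u≢v p x∉p with shorten p
    ... | ε     , _      , _   = u≢v refl
    ... | e ◅ q , q-path , q⊆p =
      acyclic (x , v , xu ◅ e ◅ q , ∉⇒All≢ (x∉p ∘ q⊆p) ∷ q-path , long q , adj-sym xv)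
      where
      long : ∀ {w} (q : Walk G w v) → 3 ≤ length (x ∷ u ∷ vertices G q)
      long ε       = s≤s (s≤s (s≤s z≤n))
      long (_ ◅ _) = s≤s (s≤s (s≤s z≤n))

    -- Where two paths from `u` first diverge, the rest of one followed by the reverse of the rest
    -- of the other joins two neighbours of `u` without meeting `u`.
    path-unique : ∀ {u v} (p q : Walk G u v) → IsPath G p → IsPath G q →
                  vertices G p ≡ vertices G q
    path-unique ε       ε       _            _            = refl
    path-unique ε       (_ ◅ q) _            (u∉q ∷ _)    = contradiction (end∈ q) (All≢⇒∉ u∉q)
    path-unique (_ ◅ p) ε       (u∉p ∷ _)    _            = contradiction (end∈ p) (All≢⇒∉ u∉p)
    path-unique (_◅_ {j = x} e p) (_◅_ {j = y} f q) (u∉p ∷ p-path) (u∉q ∷ q-path) with x ≟ᵥ y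
    ... | yes refl = cong (_ ∷_) (path-unique p q p-path q-path)
    ... | no  x≢y  = contradiction
      ([ All≢⇒∉ u∉p , All≢⇒∉ u∉q ∘ ∈-rev⁻ q ]′ ∘ ∈-◅◅⁻ p (rev q))
      (no-bypass e f x≢y (p ◅◅ rev q))

-- Parents and branches in a rooted tree.

-- The parent of v is the second vertex of the path from v to the root r,
-- with the junk value r when v is r itself.
module Rooted {n : ℕ} (G : Graph (Fin n)) (r : Fin n) (tree : IsTree G) where
  open Graph G
  open Paths _≟_ G

  path : ∀ v → Walk G v r
  path v = proj₁ (shorten (proj₁ tree v r))

  path-isPath : ∀ v → IsPath G (path v)
  path-isPath v = proj₁ (proj₂ (shorten (proj₁ tree v r)))

  branch : Fin n → List (Fin n)
  branch v = vertices G (path v)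

  branch-unique : ∀ {v} (p : Walk G v r) → IsPath G p → branch v ≡ vertices G p
  branch-unique p = path-unique (proj₂ tree) (path _) p (path-isPath _)

  second : Fin n → List (Fin n) → Fin n
  second _ (_ ∷ v ∷ _) = v
  second v _           = v

  par : Fin n → Fin n
  par v = second v (branch v)

  branch-root : branch r ≡ r ∷ []
  branch-root = branch-unique ε ([] ∷ [])

  par-root : par r ≡ r
  par-root = cong (second r) branch-root

  branch-edge : ∀ {v w} (e : Adj v w) (p : Walk G w r) → IsPath G (e ◅ p) →
                (branch v ≡ v ∷ branch w) × par v ≡ w
  branch-edge {v} {w} e p ep-path@(_ ∷ p-path) =
    v-branch , trans (cong (second v) v-branch)
                     (cong (λ l → second v (v ∷ l)) (vertices-head (path w)))
    where
    v-branch : branch v ≡ v ∷ branch w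
    v-branch = trans (branch-unique (e ◅ p) ep-path) (cong (v ∷_) (sym (branch-unique p p-path)))

  branch-step×adj-par : ∀ {v} → v ≢ r → (branch v ≡ v ∷ branch (par v)) × Adj v (par v)
  branch-step×adj-par {v} v≢r = go (path v) (path-isPath v)
    where
    go : (p : Walk G v r) → IsPath G p → (branch v ≡ v ∷ branch (par v)) × Adj v (par v)
    go ε       _       = contradiction refl v≢r
    go (e ◅ p) ep-path with branch-edge e p ep-path
    ... | eq , refl = eq , e

  branch-step : ∀ {v} → v ≢ r → branch v ≡ v ∷ branch (par v)
  branch-step = proj₁ ∘ branch-step×adj-par

  adj-par : ∀ {v} → v ≢ r → Adj v (par v)
  adj-par = proj₂ ∘ branch-step×adj-par

  -- If `v` is off the branch of `u`, then `v` put in front of that branch is a path. Otherwise the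
  -- part of the branch from `v` on, preceded by `u`, is a path. Uniqueness of paths then identifies
  -- the parent.
  adj⇒par : ∀ {u v} → Adj u v → (u ≢ r × par u ≡ v) ⊎ (v ≢ r × par v ≡ u)
  adj⇒par {u} {v} uv with _∈ˡ?_ _≟_ v (branch u)
  ... | no  v∉u = inj₂ ((λ { refl → v∉u (end∈ (path u)) }) ,
                        proj₂ (branch-edge (adj-sym uv) (path u) (∉⇒All≢ v∉u ∷ path-isPath u)))
  ... | yes v∈u = inj₁ (go (path u) (path-isPath u) v∈u)
    where
    go : (p : Walk G u r) → IsPath G p → v ∈ˡ vertices G p → u ≢ r × par u ≡ v
    go ε       _              (here refl) = contradiction uv (adj-irrefl refl)
    go (e ◅ p) _              (here refl) = contradiction uv (adj-irrefl refl)
    go (e ◅ p) (u∉p ∷ p-path) (there v∈p) =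
      let q , q-path , q⊆p = suffix p p-path v∈p in
      (λ { refl → All≢⇒∉ u∉p (end∈ p) }) ,
      proj₂ (branch-edge uv q (∉⇒All≢ (All≢⇒∉ u∉p ∘ q⊆p) ∷ q-path))

  par-isChild : ∀ {v} → v ≢ r → IsChild G r (par v) v
  par-isChild {v} v≢r =
    adj-sym (adj-par v≢r) , rev (path v) , rev-isPath (path v) (path-isPath v) ,
    ∈-rev⁺ (path v) (subst (par v ∈ˡ_) (sym (branch-step v≢r)) (there (start∈ (path (par v)))))

-- Sizes of finite subsets and of images.

∣⁅x⁆∪p∣ : ∀ {n} {x : Fin n} {p} → x ∉ p → ∣ ⁅ x ⁆ ∪ p ∣ ≡ suc ∣ p ∣
∣⁅x⁆∪p∣ {x = zero}  {inside  ∷ p} x∉p = contradiction here x∉p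
∣⁅x⁆∪p∣ {x = zero}  {outside ∷ p} x∉p = cong (suc ∘ ∣_∣) (∪-identityˡ p)
∣⁅x⁆∪p∣ {x = suc x} {inside  ∷ p} x∉p = cong suc (∣⁅x⁆∪p∣ (x∉p ∘ there))
∣⁅x⁆∪p∣ {x = suc x} {outside ∷ p} x∉p = ∣⁅x⁆∪p∣ (x∉p ∘ there)

x∈p─q⇒x∉q : ∀ {n} {x : Fin n} (p q : Subset n) → x ∈ p ─ q → x ∉ q
x∈p─q⇒x∉q (_ ∷ p) (outside ∷ q) here        ()
x∈p─q⇒x∉q (_ ∷ p) (outside ∷ q) (there x∈)  (there x∈q) = x∈p─q⇒x∉q p q x∈ x∈q
x∈p─q⇒x∉q (_ ∷ p) (inside  ∷ q) (there x∈)  (there x∈q) = x∈p─q⇒x∉q p q x∈ x∈q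

p⊆q∧∣q∣≤∣p∣⇒p≡q : ∀ {n} {p q : Subset n} → p ⊆ q → ∣ q ∣ ≤ ∣ p ∣ → p ≡ q
p⊆q∧∣q∣≤∣p∣⇒p≡q {p = p} {q} p⊆q q≤p = ⊆-antisym p⊆q λ {x} x∈q →
  decidable-stable (x ∈? p) λ x∉p → ℕ.≤⇒≯ q≤p (p⊂q⇒∣p∣<∣q∣ (p⊆q , x , x∈q , x∉p))

-- The intersection survives the removal of both `x` and `y` from `q`, which costs two elements.
two-missing : ∀ {n m} {p q : Subset n} {x y} → ∣ q ∣ ≡ suc m → x ∈ q → y ∈ q → x ≢ y →
              x ∉ p → y ∉ p → ∣ p ∩ q ∣ ≤ m ∸ 1
two-missing {m = m} {p} {q} {x} {y} ∣q∣≡ x∈q y∈q x≢y x∉p y∉p = ℕ.∸-monoˡ-≤ 1 (begin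
  suc ∣ p ∩ q ∣   ≤⟨ s≤s (p⊆q⇒∣p∣≤∣q∣ within) ⟩
  suc ∣ q - x - y ∣ ≤⟨ x∈p⇒∣p-x∣<∣p∣ (x∈p∧x≢y⇒x∈p-y y∈q (≢-sym x≢y)) ⟩
  ∣ q - x ∣       ≤⟨ s≤s⁻¹ (subst (∣ q - x ∣ <_) ∣q∣≡ (x∈p⇒∣p-x∣<∣p∣ x∈q)) ⟩
  m               ∎)
  where
  open ℕ.≤-Reasoning
  within : p ∩ q ⊆ q - x - y
  within z∈ with x∈p∩q⁻ p q z∈
  ... | z∈p , z∈q = x∈p∧x≢y⇒x∈p-y (x∈p∧x≢y⇒x∈p-y z∈q (λ { refl → x∉p z∈p })) λ { refl → y∉p z∈p }

image : ∀ {m n} → (Fin m → Fin n) → Subset n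
image {zero} f = ⊥
image {suc m}  f = ⁅ f zero ⁆ ∪ image (f ∘ suc)

∈-image⁺ : ∀ {m n} (f : Fin m → Fin n) i → f i ∈ image f
∈-image⁺ f zero    = x∈p∪q⁺ (inj₁ (x∈⁅x⁆ (f zero)))
∈-image⁺ f (suc i) = x∈p∪q⁺ (inj₂ (∈-image⁺ (f ∘ suc) i))

∈-image⁻ : ∀ {m n} (f : Fin m → Fin n) {x} → x ∈ image f → ∃[ i ] f i ≡ x
∈-image⁻ {zero} f x∈ = contradiction x∈ ∉⊥
∈-image⁻ {suc m}  f x∈ with x∈p∪q⁻ ⁅ f zero ⁆ (image (f ∘ suc)) x∈
... | inj₁ x∈₁ = zero , sym (x∈⁅y⁆⇒x≡y (f zero) x∈₁)
... | inj₂ x∈₂ = let i , eq = ∈-image⁻ (f ∘ suc) x∈₂ in suc i , eq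

∣image∣ : ∀ {m n} {f : Fin m → Fin n} → Injective _≡_ _≡_ f → ∣ image f ∣ ≡ m
∣image∣ {zero} {n}     f-inj = ∣⊥∣≡0 n
∣image∣ {suc m}  {f = f} f-inj = trans
  (∣⁅x⁆∪p∣ λ f0∈ → let _ , eq = ∈-image⁻ (f ∘ suc) f0∈ in contradiction (f-inj eq) λ ())
  (cong suc (∣image∣ (suc-injective ∘ f-inj)))

-- Away from `j` every value of `f` is also a value of `g`. With the slots of a child and of its
-- parent, in either order, this gives the two differences in a slide.
image-─ : ∀ {m n} (f g : Fin m → Fin n) j → (∀ i → i ≢ j → f i ≡ g i) → f j ∉ image g →
          image f ─ image g ≡ ⁅ f j ⁆
image-─ f g j agree fj∉ = ⊆-antisym forth back
  where
  forth : image f ─ image g ⊆ ⁅ f j ⁆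
  forth x∈ with ∈-image⁻ f (p─q⊆p (image f) (image g) x∈)
  ... | i , refl with i ≟ j
  ...   | yes refl = x∈⁅x⁆ (f i)
  ...   | no  i≢j  = contradiction (subst (_∈ image g) (sym (agree i i≢j)) (∈-image⁺ g i))
                                   (x∈p─q⇒x∉q (image f) (image g) x∈)
  back : ⁅ f j ⁆ ⊆ image f ─ image g
  back x∈ with x∈⁅y⁆⇒x≡y (f j) x∈
  ... | refl = x∈p∧x∉q⇒x∈p─q (∈-image⁺ f j) fj∉

maximizer : ∀ {n} {P : Pred (Fin n) 0ℓ} → Decidable P → (f : Fin n → ℕ) → ∃[ v ] P v →
            ∃[ v ] P v × (∀ w → P w → f w ≤ f v)
maximizer {n} P? f (v₀ , Pv₀) =
  v , argmax-all f Pv₀ (All.all-filter P? (allFin n)) ,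
  λ w Pw → All.lookup (f[xs]≤f[argmax] v₀ candidates) (∈-filter⁺ P? (∈-allFin w) Pw)
  where
  candidates = filter P? (allFin n)
  v = argmax f v₀ candidates

a-injective : ∀ {k} {i j : Fin (suc k)} → a {k} i ≡ a j → i ≡ j
a-injective refl = refl

-- The graph built from the parents, branches and sibling ranks of a tree.

module Construction
  {k n : ℕ} (r : Fin n) (par : Fin n → Fin n) (par-root : par r ≡ r)
  (branch : Fin n → List (Fin n))
  (branch-root : branch r ≡ r ∷ [])
  (branch-step : ∀ {v} → v ≢ r → branch v ≡ v ∷ branch (par v))
  (rank : Fin n → Fin k)
  (rank-injective : ∀ {u v} → u ≢ r → v ≢ r → par u ≡ par v → rank u ≡ rank v → u ≡ v)
  where

  branch-cons : ∀ v → ∃[ vs ] branch v ≡ v ∷ vs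
  branch-cons v with v ≟ r
  ... | yes refl = [] , branch-root
  ... | no  v≢r  = branch (par v) , branch-step v≢r

  -- The recursion is structural in the list `branch v`, which loses its head on passing to the
  -- parent.
  tree-induction : (P : Fin n → Set) → P r → (∀ v → v ≢ r → P (par v) → P v) → ∀ v → P v
  tree-induction P P-root P-step v = go (branch v) v refl
    where
    go : ∀ vs v → branch v ≡ vs → P v
    go []       v eq = contradiction (trans (sym eq) (proj₂ (branch-cons v))) λ ()
    go (_ ∷ vs) v eq with v ≟ r
    ... | yes refl = P-root
    ... | no  v≢r  = P-step v v≢r (go vs (par v) (∷-injectiveʳ (trans (sym (branch-step v≢r)) eq)))

  -- The ancestor order.

  infix 4 _≼_
  _≼_ : Fin n → Fin n → Set
  u ≼ v = u ∈ˡ branch v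

  depth : Fin n → ℕ
  depth v = length (branch v)

  ≼-refl : ∀ {v} → v ≼ v
  ≼-refl {v} = subst (v ∈ˡ_) (sym (proj₂ (branch-cons v))) (here refl)

  ≼-root⁻ : ∀ {u} → u ≼ r → u ≡ r
  ≼-root⁻ u≼r with here eq ← subst (_ ∈ˡ_) branch-root u≼r = eq

  ≼-par⁻ : ∀ {u v} → v ≢ r → u ≼ v → u ≡ v ⊎ u ≼ par v
  ≼-par⁻ v≢r u≼v with subst (_ ∈ˡ_) (branch-step v≢r) u≼v
  ... | here eq = inj₁ eq
  ... | there u≼ = inj₂ u≼

  ≼-par⁺ : ∀ {u v} → v ≢ r → u ≼ par v → u ≼ v
  ≼-par⁺ v≢r u≼ = subst (_ ∈ˡ_) (sym (branch-step v≢r)) (there u≼)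

  par≼ : ∀ v → par v ≼ v
  par≼ v with v ≟ r
  ... | yes refl = subst (_≼ r) (sym par-root) ≼-refl
  ... | no  v≢r  = ≼-par⁺ v≢r ≼-refl

  root≼ : ∀ v → r ≼ v
  root≼ = tree-induction (r ≼_) ≼-refl (λ _ → ≼-par⁺)

  ≼-trans : ∀ {u v w} → u ≼ v → v ≼ w → u ≼ w
  ≼-trans {u} {v} {w} u≼v = tree-induction (λ w → v ≼ w → u ≼ w)
    (λ v≼r → subst (u ≼_) (≼-root⁻ v≼r) u≼v)
    (λ w w≢r ih v≼w → [ (λ { refl → u≼v }) , ≼-par⁺ w≢r ∘ ih ]′ (≼-par⁻ w≢r v≼w))
    w

  depth-par : ∀ {v} → v ≢ r → depth (par v) < depth v
  depth-par v≢r = ℕ.≤-reflexive (sym (cong length (branch-step v≢r)))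

  depth-mono : ∀ {u v} → u ≼ v → depth u ≤ depth v
  depth-mono {u} {v} = tree-induction (λ v → u ≼ v → depth u ≤ depth v)
    (λ u≼r → ℕ.≤-reflexive (cong depth (≼-root⁻ u≼r)))
    (λ v v≢r ih u≼v → [ ℕ.≤-reflexive ∘ cong depth ,
                        (λ u≼ → ℕ.≤-trans (ih u≼) (ℕ.<⇒≤ (depth-par v≢r))) ]′ (≼-par⁻ v≢r u≼v))
    v

  ⋠par : ∀ {v} → v ≢ r → ¬ v ≼ par v
  ⋠par v≢r v≼ = ℕ.<⇒≱ (depth-par v≢r) (depth-mono v≼)

  ≼-antisym : ∀ {u v} → u ≼ v → v ≼ u → u ≡ v
  ≼-antisym {u} {v} u≼v v≼u with v ≟ r
  ... | yes refl = ≼-root⁻ u≼v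
  ... | no  v≢r  = [ id , (λ u≼ → contradiction (≼-trans v≼u u≼) (⋠par v≢r)) ]′ (≼-par⁻ v≢r u≼v)

  -- Colours of the tree vertices.

  colourOf : List (Fin n) → Fin (suc k)
  colourOf []               = zero
  colourOf (_ ∷ [])         = zero
  -- `punchIn` skips the colour of the parent, leaving `k` colours for the `k` ranks. So a child
  -- never evicts the vertex that its parent introduced, and siblings get different colours.
  colourOf (v ∷ vs@(_ ∷ _)) = punchIn (colourOf vs) (rank v)

  colour : Fin n → Fin (suc k)
  colour v = colourOf (branch v)

  colour-root : colour r ≡ zero
  colour-root = cong colourOf branch-root

  colour-step : ∀ {v} → v ≢ r → colour v ≡ punchIn (colour (par v)) (rank v)
  colour-step {v} v≢r with branch-step v≢r | branch-cons (par v)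
  ... | eq | vs , eq′ rewrite eq | eq′ = refl

  colour-par : ∀ {v} → v ≢ r → colour (par v) ≢ colour v
  colour-par {v} v≢r eq = punchInᵢ≢i (colour (par v)) (rank v) (sym (trans eq (colour-step v≢r)))

  colour-injective : ∀ {u v} → u ≢ r → v ≢ r → par u ≡ par v → colour u ≡ colour v → u ≡ v
  colour-injective {u} {v} u≢r v≢r par≡ eq = rank-injective u≢r v≢r par≡
    (punchIn-injective (colour (par v)) (rank u) (rank v)
      (trans (subst (λ p → punchIn (colour p) (rank u) ≡ colour u) par≡ (sym (colour-step u≢r)))
             (trans eq (colour-step v≢r))))

  -- Bags, with one vertex of each colour.

  vertex : Fin n → Fin (k + n)
  vertex v = k ↑ʳ v

  -- These form the bag of the root: its own vertex has colour zero, and the `k` vertices that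
  -- precede the tree vertices in `Fin (k + n)` take the other colours.
  anchor : Fin (suc k) → Fin (k + n)
  anchor zero    = vertex r
  anchor (suc i) = i ↑ˡ n

  -- The slot of colour `j` holds the vertex introduced most recently in that colour on the way down
  -- from the root, or else the anchor. A child thus differs from its parent only in the slot of its
  -- own colour.
  slotOf : List (Fin n) → Fin (suc k) → Fin (k + n)
  slotOf []       j = anchor j
  slotOf (v ∷ vs) j = if does (j ≟ colourOf (v ∷ vs)) then vertex v else slotOf vs j

  slot : Fin n → Fin (suc k) → Fin (k + n)
  slot v = slotOf (branch v)

  slot-self : ∀ v → slot v (colour v) ≡ vertex v
  slot-self v with branch v | branch-cons v
  ... | _ | vs , refl = cong (λ b → if b then vertex v else slotOf vs (colourOf (v ∷ vs)))
                             (dec-true (colourOf (v ∷ vs) ≟ colourOf (v ∷ vs)) refl)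

  slot-par : ∀ {v j} → v ≢ r → j ≢ colour v → slot v j ≡ slot (par v) j
  slot-par {v} {j} v≢r j≢ rewrite branch-step v≢r =
    cong (λ b → if b then vertex v else slotOf (branch (par v)) j) (dec-false (j ≟ _) j≢)

  slot-root : ∀ j → slot r j ≡ anchor j
  slot-root j = trans (cong (λ vs → slotOf vs j) branch-root) (singleton j)
    where
    singleton : ∀ j → slotOf (r ∷ []) j ≡ anchor j
    singleton zero    = refl
    singleton (suc _) = refl

  hue : Fin (k + n) → Fin (suc k)
  hue x = [ suc , colour ]′ (splitAt k x)

  hue-vertex : ∀ v → hue (vertex v) ≡ colour v
  hue-vertex v = cong [ suc , colour ]′ (splitAt-↑ʳ k n v)

  hue-anchor : ∀ j → hue (anchor j) ≡ j
  hue-anchor zero    = trans (hue-vertex r) colour-root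
  hue-anchor (suc i) = cong [ suc , colour ]′ (splitAt-↑ˡ k i n)

  -- A new vertex has the colour of the one it replaces. Hence `slot v` is injective, and members of
  -- one bag are determined by their hue.
  hue-slot : ∀ v j → hue (slot v j) ≡ j
  hue-slot v j = tree-induction (λ v → hue (slot v j) ≡ j)
    (trans (cong hue (slot-root j)) (hue-anchor j)) step v
    where
    step : ∀ v → v ≢ r → hue (slot (par v) j) ≡ j → hue (slot v j) ≡ j
    step v v≢r ih with j ≟ colour v
    ... | yes refl = trans (cong hue (slot-self v)) (hue-vertex v)
    ... | no  j≢   = trans (cong hue (slot-par v≢r j≢)) ih

  -- The vertex of `u` enters at the bag of `u` and is passed on only to descendants.
  slot-≼ : ∀ {u v j} → slot v j ≡ vertex u → u ≼ v
  slot-≼ {u} {v} {j} = tree-induction (λ v → slot v j ≡ vertex u → u ≼ v)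
    (λ eq → subst (_≼ r) (sym (anchor-vertex {j} (trans (sym (slot-root j)) eq))) ≼-refl) step v
    where
    anchor-vertex : ∀ {j} → anchor j ≡ vertex u → u ≡ r
    anchor-vertex {zero}  eq = sym (↑ʳ-injective k r u eq)
    anchor-vertex {suc i} eq = contradiction
      (trans (sym (splitAt-↑ˡ k i n)) (trans (cong (splitAt k) eq) (splitAt-↑ʳ k n u))) λ ()
    step : ∀ v → v ≢ r → (slot (par v) j ≡ vertex u → u ≼ par v) → slot v j ≡ vertex u → u ≼ v
    step v v≢r ih eq with j ≟ colour v
    ... | yes refl = subst (_≼ v) (↑ʳ-injective k v u (trans (sym (slot-self v)) eq)) ≼-refl
    ... | no  j≢   = ≼-par⁺ v≢r (ih (trans (sym (slot-par v≢r j≢)) eq))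

  bag : Fin n → Subset (k + n)
  bag v = image (slot v)

  ∈-bag : ∀ {v x} → x ∈ bag v → slot v (hue x) ≡ x
  ∈-bag {v} x∈ with ∈-image⁻ (slot v) x∈
  ... | j , refl = cong (slot v) (hue-slot v j)

  vertex∈bag : ∀ v → vertex v ∈ bag v
  vertex∈bag v = subst (_∈ bag v) (slot-self v) (∈-image⁺ (slot v) (colour v))

  ∈-bag⇒≼ : ∀ {u v} → vertex u ∈ bag v → u ≼ v
  ∈-bag⇒≼ {v = v} u∈ = slot-≼ (proj₂ (∈-image⁻ (slot v) u∈))

  -- Each bag contains the vertex of its own node, so nodes with equal bags are ancestors of each
  -- other.
  bag-injective : ∀ {u v} → bag u ≡ bag v → u ≡ v
  bag-injective {u} {v} eq = ≼-antisym (∈-bag⇒≼ (subst (vertex u ∈_) eq (vertex∈bag u)))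
                                       (∈-bag⇒≼ (subst (vertex v ∈_) (sym eq) (vertex∈bag v)))

  slot-injective : ∀ v → Injective _≡_ _≡_ (slot v)
  slot-injective v {i} {j} eq = trans (sym (hue-slot v i)) (trans (cong hue eq) (hue-slot v j))

  ∣bag∣ : ∀ v → ∣ bag v ∣ ≡ suc k
  ∣bag∣ v = ∣image∣ (slot-injective v)

  -- The vertices introduced strictly below v are deeper than v.
  bag-ancestor : ∀ {u v x} → v ≼ u → (∀ w → x ≡ vertex w → depth w ≤ depth v) → x ∈ bag u → x ∈ bag v
  bag-ancestor {u} {v} {x} v≼u shallow x∈ = tree-induction (λ u → v ≼ u → x ∈ bag u → x ∈ bag v)
    (λ v≼r x∈r → subst (λ t → x ∈ bag t) (sym (≼-root⁻ v≼r)) x∈r) step u v≼u x∈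
    where
    step : ∀ u → u ≢ r → (v ≼ par u → x ∈ bag (par u) → x ∈ bag v) → v ≼ u → x ∈ bag u → x ∈ bag v
    step u u≢r ih v≼u x∈u with ≼-par⁻ u≢r v≼u
    ... | inj₁ refl = x∈u
    ... | inj₂ v≼p with hue x ≟ colour u
    ...   | no  h≢ = ih v≼p (subst (_∈ bag (par u)) (trans (sym (slot-par u≢r h≢)) (∈-bag x∈u))
                                   (∈-image⁺ (slot (par u)) (hue x)))
    ...   | yes h≡ = contradiction
      (shallow u (trans (sym (∈-bag x∈u)) (trans (cong (slot u) h≡) (slot-self u))))
      (ℕ.<⇒≱ (ℕ.≤-<-trans (depth-mono v≼p) (depth-par u≢r)))

  -- The graph and its independent sets of size `k + 1`.

  Together : (x y : Fin (k + n)) → Set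
  Together x y = ∃[ v ] x ∈ bag v × y ∈ bag v

  together? : ∀ x y → Dec (Together x y)
  together? x y = any? λ v → x ∈? bag v ×-dec y ∈? bag v

  graph : Graph (Fin (k + n))
  graph = record
    { Adj        = λ x y → x ≢ y × ¬ Together x y
    ; adj?       = λ x y → ¬? (x ≟ y) ×-dec ¬? (together? x y)
    ; adj-sym    = λ (x≢y , apart) → ≢-sym x≢y , λ (v , y∈ , x∈) → apart (v , x∈ , y∈)
    ; adj-irrefl = λ x≡y (x≢y , _) → x≢y x≡y
    }

  T : Graph (Node graph (suc k))
  T = TS graph (suc k)

  bag-independent : ∀ v → Independent graph (bag v)
  bag-independent v x∈ y∈ (_ , apart) = apart (v , x∈ , y∈)

  bagNode : Fin n → Node graph (suc k)
  bagNode v = node (bag v) (∣bag∣ v) (bag-independent v)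

  node-≡ : ∀ {I J : Node graph (suc k)} → set I ≡ set J → I ≡ J
  node-≡ refl = refl

  -- Only `k` vertices of the graph do not come from the tree.
  contains-vertex : ∀ {I} → ∣ I ∣ ≡ suc k → ∃[ v ] vertex v ∈ I
  contains-vertex {I} ∣I∣≡ = decidable-stable (any? λ v → vertex v ∈? I) λ none →
    ℕ.1+n≰n (subst₂ _≤_ ∣I∣≡ (∣image∣ (λ {i} {j} → ↑ˡ-injective n i j)) (p⊆q⇒∣p∣≤∣q∣ (only-anchors none)))
    where
    only-anchors : ¬ (∃[ v ] vertex v ∈ I) → I ⊆ image {k} (_↑ˡ n)
    only-anchors none {x} x∈ with splitAt k x | join-splitAt k n x
    ... | inj₁ i | refl = ∈-image⁺ (_↑ˡ n) i
    ... | inj₂ v | refl = contradiction (v , x∈) none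

  -- Let `v` be deepest with its vertex in `I`. Any `x` in `I` shares a bag with that vertex, and
  -- the node of this bag is a descendant of `v`. Since `x` is not deeper than `v`, it was already
  -- in the bag of `v`. Equal sizes turn the inclusion into equality.
  independent⇒bag : ∀ {I} → ∣ I ∣ ≡ suc k → Independent graph I → ∃[ v ] bag v ≡ I
  independent⇒bag {I} ∣I∣≡ I-indep with maximizer (λ v → vertex v ∈? I) depth (contains-vertex ∣I∣≡)
  ... | v , v∈I , deepest = v , sym
    (p⊆q∧∣q∣≤∣p∣⇒p≡q I⊆bag (ℕ.≤-reflexive (trans (∣bag∣ v) (sym ∣I∣≡))))
    where
    I⊆bag : I ⊆ bag v
    I⊆bag {x} x∈I with x ≟ vertex v
    ... | yes refl = vertex∈bag v
    ... | no  x≢v with decidable-stable (together? x (vertex v)) (λ apart → I-indep x∈I v∈I (x≢v , apart))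
    ...   | u , x∈u , v∈u = bag-ancestor (∈-bag⇒≼ v∈u) (λ { w refl → deepest w x∈I }) x∈u

  -- The proofs inside a `Node` are irrelevant, so the witness is found again by a decidable search.
  bagOf : (I : Node graph (suc k)) → ∃[ v ] bag v ≡ set I
  bagOf (node I ∣I∣≡ I-indep) =
    recompute (any? λ v → ≡-dec _≟ᵇ_ (bag v) I) (independent⇒bag ∣I∣≡ I-indep)

  -- Slides are exactly the tree edges.

  par-slide : ∀ {v} → v ≢ r → Graph.Adj T (bagNode v) (bagNode (par v))
  -- Moving up to the parent trades the vertex introduced at `v` for the one of the same colour that
  -- it replaced.
  par-slide {v} v≢r = slot v j , slot p j ,
    image-─ (slot v) (slot p) j (λ i → slot-par v≢r) v∉ ,
    image-─ (slot p) (slot v) j (λ i → sym ∘ slot-par v≢r) p∉ ,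
    differ , apart
    where
    p = par v
    j = colour v
    differ : slot v j ≢ slot p j
    differ eq = ⋠par v≢r (slot-≼ (trans (sym eq) (slot-self v)))
    v∉ : slot v j ∉ bag p
    v∉ v∈ = ⋠par v≢r (∈-bag⇒≼ (subst (_∈ bag p) (slot-self v) v∈))
    p∉ : slot p j ∉ bag v
    p∉ p∈ = differ (trans (cong (slot v) (sym (hue-slot p j))) (∈-bag p∈))
    -- Both have hue `j`, and a bag holds a single vertex of each hue.
    apart : ¬ Together (slot v j) (slot p j)
    apart (w , v∈ , p∈) = differ (trans (sym (∈-bag v∈))
      (trans (cong (slot w) (trans (hue-slot v j) (sym (hue-slot p j)))) (∈-bag p∈)))

  AgreeOff : Fin (suc k) → Fin n → Fin n → Set
  AgreeOff j u v = ∀ i → i ≢ j → slot u i ≡ slot v i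

  -- If `u` does not have colour `j`, agreement puts the vertex of `u` itself into the bag of `v`.
  -- If it does, its parent has another colour; the parent's vertex is still in the bag of `u`,
  -- hence also in that of `v`.
  agree⇒par≼ : ∀ {u v j} → AgreeOff j u v → par u ≼ v
  agree⇒par≼ {u} {v} {j} agree with u ≟ r | colour u ≟ j
  ... | yes refl | _       = subst (_≼ v) (sym par-root) (root≼ v)
  ... | no u≢r   | no  c≢j = ≼-trans (par≼ u) (slot-≼ (trans (sym (agree _ c≢j)) (slot-self u)))
  ... | no u≢r   | yes c≡j = slot-≼ (begin
    slot v (colour (par u))       ≡⟨ agree _ (λ eq → colour-par u≢r (trans eq (sym c≡j))) ⟨
    slot u (colour (par u))       ≡⟨ slot-par u≢r (colour-par u≢r) ⟩
    slot (par u) (colour (par u)) ≡⟨ slot-self (par u) ⟩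
    vertex (par u)                ∎)
    where open ≡-Reasoning

  -- Siblings have different colours, so at least one of these is not `j`. Agreement in that colour
  -- would place the vertex of that sibling in the bag of the common parent.
  siblings-disagree : ∀ {u v j} → u ≢ r → v ≢ r → u ≢ v → par u ≡ par v → ¬ AgreeOff j u v
  siblings-disagree {u} {v} {j} u≢r v≢r u≢v par≡ agree with colour u ≟ j
  ... | no  c≢j = ⋠par u≢r (subst (u ≼_) (sym par≡) (slot-≼
    (trans (sym (slot-par v≢r c≢)) (trans (sym (agree _ c≢j)) (slot-self u)))))
    where c≢ = u≢v ∘ colour-injective u≢r v≢r par≡
  ... | yes refl = ⋠par v≢r (subst (v ≼_) par≡ (slot-≼
    (trans (sym (slot-par u≢r c≢)) (trans (agree _ c≢) (slot-self v)))))
    where c≢ = u≢v ∘ sym ∘ colour-injective v≢r u≢r (sym par≡)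

  agree⇒related : ∀ {u v j} → u ≢ v → AgreeOff j u v → (u ≢ r × par u ≡ v) ⊎ (v ≢ r × par v ≡ u)
  agree⇒related {u} {v} u≢v agree with u ≟ r | v ≟ r
  ... | yes refl | yes refl = contradiction refl u≢v
  ... | yes refl | no  v≢r  = inj₂ (v≢r , ≼-root⁻ (agree⇒par≼ λ i → sym ∘ agree i))
  ... | no  u≢r  | yes refl = inj₁ (u≢r , ≼-root⁻ (agree⇒par≼ agree))
  ... | no  u≢r  | no  v≢r
    with ≼-par⁻ v≢r (agree⇒par≼ agree) | ≼-par⁻ u≢r (agree⇒par≼ λ i → sym ∘ agree i)
  ...   | inj₁ eq | _       = inj₁ (u≢r , eq)
  ...   | _       | inj₁ eq = inj₂ (v≢r , eq)
  -- Here each parent is an ancestor of the other, so `u` and `v` are siblings.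
  ...   | inj₂ ≼₁ | inj₂ ≼₂ = contradiction agree
                                (siblings-disagree u≢r v≢r u≢v (≼-antisym ≼₁ ≼₂))

  -- Every vertex of the bag of `u` other than `x` is also in the bag of `v`, where its hue forces
  -- it into the same slot.
  slide⇒related : ∀ {u v} → Graph.Adj T (bagNode u) (bagNode v) →
                  (u ≢ r × par u ≡ v) ⊎ (v ≢ r × par v ≡ u)
  slide⇒related {u} {v} s@(x , y , u─v≡ , _) =
    agree⇒related {j = hue x} (λ { refl → Graph.adj-irrefl T {bagNode u} refl s }) agree
    where
    agree : AgreeOff (hue x) u v
    agree i i≢ with slot u i ∈? bag v
    ... | yes ∈v = trans (sym (∈-bag ∈v)) (cong (slot v) (hue-slot u i))
    ... | no  ∉v = contradiction
      (trans (sym (hue-slot u i)) (cong hue (x∈⁅y⁆⇒x≡y x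
        (subst (slot u i ∈_) u─v≡ (x∈p∧x∉q⇒x∈p─q (∈-image⁺ (slot u) i) ∉v)))))
      i≢

  rootedIso : (F : Graph (Fin n)) →
              (∀ {u v} → Graph.Adj F u v → (u ≢ r × par u ≡ v) ⊎ (v ≢ r × par v ≡ u)) →
              (∀ {v} → v ≢ r → Graph.Adj F v (par v)) →
              RootedIso F r T (bagNode r)
  rootedIso F adj⇒par adj-par = record
    { bijection     = mk↔ₛ′ bagNode (proj₁ ∘ bagOf) (node-≡ ∘ proj₂ ∘ bagOf)
                            (λ v → bag-injective (proj₂ (bagOf (bagNode v))))
    ; preservesAdj  = λ u v → mk⇔
        ([ (λ { (u≢r , refl) → par-slide u≢r })
         , (λ { (v≢r , refl) → Graph.adj-sym T {bagNode v} {bagNode (par v)} (par-slide v≢r) }) ]′ ∘ adj⇒par)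
        ([ (λ { (u≢r , refl) → adj-par u≢r })
         , (λ { (v≢r , refl) → Graph.adj-sym F (adj-par v≢r) }) ]′ ∘ slide⇒related)
    ; preservesRoot = refl
    }

  -- The bag of `v` holds the vertices of `v` and of its parent, which differ in colour, and neither
  -- lies in the bag of the root.
  far-bag : ∀ {v} → v ≢ r → par v ≢ r → ∣ bag r ∩ bag v ∣ ≤ k ∸ 1
  far-bag {v} v≢r p≢r = two-missing (∣bag∣ v) (vertex∈bag v)
    (subst (_∈ bag v) (trans (slot-par v≢r (colour-par v≢r)) (slot-self (par v)))
           (∈-image⁺ (slot v) (colour (par v))))
    (λ eq → colour-par v≢r (cong colour (sym (↑ʳ-injective k v (par v) eq))))
    (v≢r ∘ ≼-root⁻ ∘ ∈-bag⇒≼)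
    (p≢r ∘ ≼-root⁻ ∘ ∈-bag⇒≼)

  -- Canonical labels.

  nodeLabel : Fin n → Label k
  nodeLabel v with v ≟ r | par v ≟ r
  -- This is the one `a` that no child of the root may give up, as `childLabels` removes only those
  -- indexed through `inject₁`. It suits colour zero, which no child of the root has.
  ... | yes _ | _     = a (fromℕ k)
  ... | no _  | yes _ = b (rank v)
  ... | no _  | no _  = other (toℕ v)

  nodeLabel-root : nodeLabel r ≡ a (fromℕ k)
  nodeLabel-root with r ≟ r | par r ≟ r
  ... | yes _  | _ = refl
  ... | no r≢r | _ = contradiction refl r≢r

  nodeLabel-child : ∀ {v} → v ≢ r → par v ≡ r → nodeLabel v ≡ b (rank v)
  nodeLabel-child {v} v≢r p≡r with v ≟ r | par v ≟ r
  ... | yes v≡r | _      = contradiction v≡r v≢r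
  ... | no _    | yes _  = refl
  ... | no _    | no p≢r = contradiction p≡r p≢r

  nodeLabel-a⁻ : ∀ {v i} → nodeLabel v ≡ a i → v ≡ r × i ≡ fromℕ k
  nodeLabel-a⁻ {v} eq with v ≟ r | par v ≟ r
  nodeLabel-a⁻ refl | yes v≡r | _     = v≡r , refl
  nodeLabel-a⁻ ()   | no _    | yes _
  nodeLabel-a⁻ ()   | no _    | no _

  nodeLabel-b⁻ : ∀ {v i} → nodeLabel v ≡ b i → v ≢ r × par v ≡ r × rank v ≡ i
  nodeLabel-b⁻ {v} eq with v ≟ r | par v ≟ r
  nodeLabel-b⁻ ()   | yes _  | _
  nodeLabel-b⁻ refl | no v≢r | yes p≡r = v≢r , p≡r , refl
  nodeLabel-b⁻ ()   | no _   | no _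

  nodeLabel-other⁻ : ∀ {v i} → nodeLabel v ≡ other i → toℕ v ≡ i
  nodeLabel-other⁻ {v} eq with v ≟ r | par v ≟ r
  nodeLabel-other⁻ ()   | yes _ | _
  nodeLabel-other⁻ ()   | no _  | yes _
  nodeLabel-other⁻ refl | no _  | no _ = refl

  nodeLabel-injective : Injective _≡_ _≡_ nodeLabel
  nodeLabel-injective {u} {v} eq with nodeLabel u in equ
  ... | a i = trans (proj₁ (nodeLabel-a⁻ equ)) (sym (proj₁ (nodeLabel-a⁻ (sym eq))))
  ... | other i = toℕ-injective (trans (nodeLabel-other⁻ equ) (sym (nodeLabel-other⁻ (sym eq))))
  ... | b i with nodeLabel-b⁻ equ | nodeLabel-b⁻ (sym eq)
  ...   | u≢r , pu , ru | v≢r , pv , rv =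
    rank-injective u≢r v≢r (trans pu (sym pv)) (trans ru (sym rv))

  label⊎ : Fin k ⊎ Fin n → Label k
  label⊎ (inj₁ i) = a (inject₁ i)
  label⊎ (inj₂ v) = nodeLabel v

  label⊎-injective : Injective _≡_ _≡_ label⊎
  label⊎-injective {inj₁ i} {inj₁ j} eq = cong inj₁ (inject₁-injective (a-injective eq))
  label⊎-injective {inj₁ i} {inj₂ v} eq = contradiction (sym (proj₂ (nodeLabel-a⁻ (sym eq)))) fromℕ≢inject₁
  label⊎-injective {inj₂ u} {inj₁ j} eq = contradiction (sym (proj₂ (nodeLabel-a⁻ eq))) fromℕ≢inject₁
  label⊎-injective {inj₂ u} {inj₂ v} eq = cong inj₂ (nodeLabel-injective eq)

  labelled : LabelledGraph (Label k)
  labelled = record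
    { graph           = graph
    ; label           = label⊎ ∘ splitAt k
    ; label-injective = λ {x} {y} eq → trans (sym (join-splitAt k n x))
        (trans (cong (join k n) (label⊎-injective {splitAt k x} {splitAt k y} eq)) (join-splitAt k n y))
    }

  open LabelledGraph labelled using (label; labels)

  label-vertex : ∀ v → label (vertex v) ≡ nodeLabel v
  label-vertex v = cong label⊎ (splitAt-↑ʳ k n v)

  label-b⁻ : ∀ {x i} → label x ≡ b i → ∃[ v ] v ≢ r × par v ≡ r × rank v ≡ i
  label-b⁻ {x} eq with splitAt k x
  ... | inj₂ v = v , nodeLabel-b⁻ eq

  -- The root is labelled a_{k+1}, but its colour is zero.
  anchorIndex : Fin (suc k) → Fin (suc k)
  anchorIndex zero    = fromℕ k
  anchorIndex (suc i) = inject₁ i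

  anchorIndex-surjective : ∀ i → ∃[ j ] anchorIndex j ≡ i
  anchorIndex-surjective i with Top.view i
  ... | Top.‵fromℕ     = zero , refl
  ... | Top.‵inject₁ i = suc i , refl

  label-anchor : ∀ j → label (anchor j) ≡ a (anchorIndex j)
  label-anchor zero    = trans (label-vertex r) nodeLabel-root
  label-anchor (suc i) = cong label⊎ (splitAt-↑ˡ k i n)

  rootLabels : labels (bag r) ≐ Iₖ₊₁
  rootLabels = forth , back
    where
    forth : ∀ {x} → labels (bag r) x → Iₖ₊₁ x
    forth (y , y∈ , refl) with ∈-image⁻ (slot r) y∈
    ... | j , refl = anchorIndex j , trans (cong label (slot-root j)) (label-anchor j)
    back : ∀ {x} → Iₖ₊₁ x → labels (bag r) x
    back (i , refl) with anchorIndex-surjective i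
    ... | j , refl = slot r j , ∈-image⁺ (slot r) j , trans (cong label (slot-root j)) (label-anchor j)

  childBagLabels : ∀ {v} → v ≢ r → par v ≡ r → labels (bag v) ≐ childLabels (rank v)
  childBagLabels {v} v≢r p≡r = forth , back
    where
    -- `punchIn zero` is `suc`, so the child of rank `i` gives up the anchor labelled
    -- `a (inject₁ i)`.
    colour≡ : colour v ≡ suc (rank v)
    colour≡ = trans (colour-step v≢r)
      (cong (λ c → punchIn c (rank v)) (trans (cong colour p≡r) colour-root))

    self : label (slot v (colour v)) ≡ b (rank v)
    self = trans (cong label (slot-self v)) (trans (label-vertex v) (nodeLabel-child v≢r p≡r))

    rest : ∀ {j} → j ≢ colour v → label (slot v j) ≡ a (anchorIndex j)
    rest {j} j≢ = trans (cong label (trans (slot-par v≢r j≢)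
      (trans (cong (λ p → slot p j) p≡r) (slot-root j)))) (label-anchor j)

    anchorIndex-≢ : ∀ {j i} → j ≢ suc i → a {k} (anchorIndex j) ≢ a (inject₁ i)
    anchorIndex-≢ {zero}  {i} j≢ eq = fromℕ≢inject₁ (a-injective eq)
    anchorIndex-≢ {suc _} {i} j≢ eq = j≢ (cong suc (inject₁-injective (a-injective eq)))

    forth : ∀ {x} → labels (bag v) x → childLabels (rank v) x
    forth (y , y∈ , refl) with ∈-image⁻ (slot v) y∈
    ... | j , refl with j ≟ colour v
    ...   | yes refl = inj₂ self
    ...   | no  j≢   = inj₁ ((anchorIndex j , rest j≢) ,
                             anchorIndex-≢ (λ eq → j≢ (trans eq (sym colour≡))) ∘ trans (sym (rest j≢)))

    back : ∀ {x} → childLabels (rank v) x → labels (bag v) x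
    back (inj₂ refl) = slot v (colour v) , ∈-image⁺ (slot v) (colour v) , self
    back (inj₁ ((i , refl) , x≢)) with anchorIndex-surjective i
    ... | j , refl = slot v j , ∈-image⁺ (slot v) j , rest (λ { refl → x≢ (cong (a ∘ anchorIndex) colour≡) })

-- Numbering the children of each vertex.

lookup-injective : ∀ {A : Set} {xs : List A} → Unique xs → Injective _≡_ _≡_ (List.lookup xs)
lookup-injective {xs = _ ∷ _}  _                  {zero}  {zero}  _  = refl
lookup-injective {xs = _ ∷ xs} (x∉ ∷ _)           {zero}  {suc j} eq = contradiction eq (All.lookup x∉ (∈-lookup j))
lookup-injective {xs = _ ∷ xs} (x∉ ∷ _)           {suc i} {zero}  eq = contradiction (sym eq) (All.lookup x∉ (∈-lookup i))
lookup-injective {xs = _ ∷ _}  (_ ∷ xs-unique)    {suc i} {suc j} eq = cong suc (lookup-injective xs-unique eq)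

adj⇒isChild : ∀ {V : Set} {G : Graph V} {r v} → Graph.Adj G r v → IsChild G r r v
adj⇒isChild {G = G} e =
  e , e ◅ ε , ((λ eq → Graph.adj-irrefl G eq e) All.∷ All.[]) ∷ (All.[] ∷ []) , here refl

module Ranked {k : ℕ} (F : KaryTree (suc k)) where
  open KaryTree F renaming (order to n; root to r)
  open IsKaryTree isKaryTree
  open Rooted graph r isTree public

  -- The root is excluded explicitly, since by convention it is its own parent.
  children : Fin n → List (Fin n)
  children p = filter (λ v → ¬? (v ≟ r) ×-dec par v ≟ p) (allFin n)

  children-unique : ∀ p → Unique (children p)
  children-unique p = Unique.filter⁺ _ (Unique.allFin⁺ n)

  ∈-children⁻ : ∀ {p v} → v ∈ˡ children p → v ≢ r × par v ≡ p
  ∈-children⁻ = proj₂ ∘ ∈-filter⁻ _ {xs = allFin n}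

  ∣children∣≤ : ∀ p → length (children p) ≤ suc k
  ∣children∣≤ p = fewChildren p (children p) (children-unique p)
    (All.tabulate λ v∈ → let v≢r , eq = ∈-children⁻ v∈ in
      subst (λ p → IsChild graph r p _) eq (par-isChild v≢r))

  ∈-children : ∀ {v} → v ≢ r → v ∈ˡ children (par v)
  ∈-children {v} v≢r = ∈-filter⁺ _ (∈-allFin v) (v≢r , refl)

  rank : Fin n → Fin (suc k)
  rank v with v ≟ r
  -- A junk value at the root, available because the arity is a successor.
  ... | yes _  = zero
  ... | no v≢r = inject≤ (index (∈-children v≢r)) (∣children∣≤ (par v))

  rank-index : ∀ {v} → v ≢ r → Σ[ v∈ ∈ v ∈ˡ children (par v) ] toℕ (rank v) ≡ toℕ (index v∈)
  rank-index {v} v≢r with v ≟ r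
  ... | yes v≡r = contradiction v≡r v≢r
  ... | no v≢r  = ∈-children v≢r , toℕ-inject≤ _ (∣children∣≤ (par v))

  rank-injective : ∀ {u v} → u ≢ r → v ≢ r → par u ≡ par v → rank u ≡ rank v → u ≡ v
  rank-injective {u} {v} u≢r v≢r par≡ rank≡ with rank-index u≢r | rank-index v≢r
  ... | u∈ , equ | v∈ , eqv rewrite par≡ = index-injective (setoid (Fin n)) u∈ v∈
    (toℕ-injective (trans (sym equ) (trans (cong toℕ rank≡) eqv)))

  rank<∣children∣ : ∀ {v} → v ≢ r → toℕ (rank v) < length (children (par v))
  rank<∣children∣ v≢r with rank-index v≢r
  ... | v∈ , eq = subst (_< _) (sym eq) (toℕ<n (index v∈))

  -- The list of children has no repetition, so the entry at position `i` can only be found at that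
  -- position.
  rank-surjective : ∀ {p i} → toℕ i < length (children p) → ∃[ v ] v ≢ r × par v ≡ p × rank v ≡ i
  rank-surjective {p} {i} i< with List.lookup (children p) (fromℕ< i<) in v≡
  ... | v with ∈-children⁻ (subst (_∈ˡ children p) v≡ (∈-lookup (fromℕ< i<)))
  ...   | v≢r , refl with rank-index v≢r
  ...     | v∈ , eq = v , v≢r , refl , toℕ-injective (begin
    toℕ (rank v)    ≡⟨ eq ⟩
    toℕ (index v∈)  ≡⟨ cong toℕ (lookup-injective (children-unique _)
                                   (trans (sym (lookup-index v∈)) (sym v≡))) ⟩
    toℕ (fromℕ< i<) ≡⟨ toℕ-fromℕ< i< ⟩
    toℕ i           ∎)
    where open ≡-Reasoning

proposition19 : (k : ℕ) → 2 ≤ k → (T : KaryTree k) →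
    Σ[ G ∈ LabelledGraph (Label k) ] Σ[ root ∈ Node (LabelledGraph.graph G) (suc k) ]
    CanonicallyLabelled G root ×
    RootedIso (KaryTree.graph T) (KaryTree.root T) (TS (LabelledGraph.graph G) (suc k)) root
proposition19 (suc k) _ F = labelled , bagNode r , canonical , iso
  where
  open KaryTree F renaming (graph to tree; root to r)
  open Ranked F
  open Construction r par par-root branch branch-root branch-step rank rank-injective

  iso : RootedIso tree r T (bagNode r)
  iso = rootedIso tree adj⇒par adj-par

  root-child : ∀ {v} → v ≢ r → par v ≡ r → IsChild T (bagNode r) (bagNode r) (bagNode v)
  root-child {v} v≢r p≡r = adj⇒isChild {G = T} (Graph.adj-sym T {bagNode v} {bagNode r}
    (subst (λ p → Graph.Adj T (bagNode v) (bagNode p)) p≡r (par-slide v≢r)))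

  root-child⁻ : ∀ {v} → IsChild T (bagNode r) (bagNode r) (bagNode v) → v ≢ r × par v ≡ r
  root-child⁻ {v} (e , _) = [ (λ (r≢r , _) → contradiction refl r≢r) , id ]′ (slide⇒related {r} {v} e)

  -- Every node of `T` is a bag, so claims about nodes need checking only at tree vertices.
  onBags : (P : Node graph (suc (suc k)) → Set) → (∀ v → P (bagNode v)) → ∀ J → P J
  onBags P P-bag J = let v , eq = bagOf J in subst P (node-≡ eq) (P-bag v)

  canonical : CanonicallyLabelled labelled (bagNode r)
  canonical = record
    { isKaryTree    = isKaryTree-resp-≃ iso isKaryTree
    ; rootLabel     = rootLabels
    -- The ranks of the children of the root fill an initial segment, so the labels `b` from `d` on
    -- never occur.
    ; d             = length (children r)
    ; d≤k           = ∣children∣≤ r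
    ; childExists   = λ i i< → existing (rank-surjective i<)
    ; childLabelled = onBags _ λ v child → let v≢r , p≡r = root-child⁻ child in
        rank v , subst (λ p → toℕ (rank v) < length (children p)) p≡r (rank<∣children∣ v≢r) ,
        childBagLabels v≢r p≡r
    ; unusedLabels  = λ j d≤j x x≡ → unused d≤j (label-b⁻ {x} x≡)
    ; otherNodes    = onBags _ λ v J≢root J-no-child →
        far-bag (J≢root ∘ cong bagNode) (J-no-child ∘ root-child (J≢root ∘ cong bagNode))
    }
    where
    existing : ∀ {i} → ∃[ v ] v ≢ r × par v ≡ r × rank v ≡ i →
               ∃[ J ] IsChild T (bagNode r) (bagNode r) J ×
                      (LabelledGraph.labels labelled (set J) ≐ childLabels i)
    existing (v , v≢r , p≡r , refl) = bagNode v , root-child v≢r p≡r , childBagLabels v≢r p≡r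

    unused : ∀ {j} → length (children r) ≤ toℕ j → ¬ (∃[ v ] v ≢ r × par v ≡ r × rank v ≡ j)
    unused d≤j (v , v≢r , p≡r , refl) =
      ℕ.<⇒≱ (subst (λ p → toℕ (rank v) < length (children p)) p≡r (rank<∣children∣ v≢r)) d≤j
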